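{- Let $n\geq 8$ be an integer with $n\not\equiv 1\pmod 3$. Let $\widetilde{L}$ be the $n\times n$ matrix $$\widetilde{L}=\frac{n-1}{3}I_n-\frac13\begin{bmatrix}0&\mathbf{e}'\\ \mathbf{e}&\mathbf{0}\end{bmatrix}+\begin{bmatrix}0&\mathbf{0}'\\ \mathbf{0}&M\end{bmatrix},$$ where $M=\frac13\operatorname{Circ}(\bar{\mathbf{x}}')$ if $n\equiv 2\pmod 3$ and $M=\frac13\operatorname{Circ}(\bar{\mathbf{y}}')$ if $n\equiv 0\pmod 3$, with $\bar{\mathbf{x}},\bar{\mathbf{y}}\in\mathbb{R}^{n-1}$ given by $$\bar{\mathbf{x}}=(2-n,\underbrace{1,-2,1},\dots,\underbrace{1,-2,1})',\qquad \bar{\mathbf{y}}=(-n,\underbrace{2,-1,-1},\dots,\underbrace{2,-1,-1},2)'.$$ Then the rank of $\widetilde{L}$ is $n-1$.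
   Context: The prime denotes transpose, $I_n$ is the identity matrix, and $\mathbf{e}$ denotes the all-ones column vector (here in $\mathbb{R}^{n-1}$). In the block matrices the blocks have sizes $1$ and $n-1$. For a vector $\mathbf{c}=(c_1,\dots,c_m)'$, $\operatorname{Circ}(\mathbf{c}')$ is the $m\times m$ circulant matrix with first row $(c_1,\dots,c_m)$ and each subsequent row the cyclic right shift by one of the previous row. -}

module Defs where

open import Algebra.Apartness.Bundles using (HeytingField; HeytingCommutativeRing)
open import Algebra.Bundles using (CommutativeRing)
import Algebra.Definitions.RawMonoid as RawMonoidDefs
open import Data.Bool.Base using (if_then_else_)
open import Data.Fin.Base using (Fin; zero; suc; toℕ)
open import Data.Fin.Properties using (_≟_)
open import Data.Nat.Base using (ℕ; zero; suc; _∸_)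
open import Data.Nat.DivMod using (_%_; _mod_)
open import Data.Product.Base using (∃-syntax; proj₁)
open import Data.Vec.Functional using (Vector; []; _∷_; last; init)
open import Level using (Level; _⊔_)
open import Relation.Nullary.Decidable.Core using (⌊_⌋)

Matrix : ∀ {a} → Set a → ℕ → ℕ → Set a
Matrix A m n = Vector (Vector A n) m

-- The scalars are those of an arbitrary (constructive) field, the library
-- having no real numbers; ℝ and ℚ are instances.

module FieldDefs {c ℓ₁ ℓ₂ : Level} (F : HeytingField c ℓ₁ ℓ₂) where

  open HeytingField F
  open CommutativeRing (HeytingCommutativeRing.commutativeRing heytingCommutativeRing)
    using (+-rawMonoid)
  open RawMonoidDefs +-rawMonoid using (sum; _×_)

  fromℕ : ℕ → Carrier
  fromℕ n = n × 1#

  CharacteristicZero : Set ℓ₂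
  CharacteristicZero = ∀ n → fromℕ (suc n) # 0#

  -- The library's #⇒invertible inverts x - 0#, which equals x.
  inverse : ∀ x → x # 0# → Carrier
  inverse _ x#0 = proj₁ (#⇒invertible x#0)

  linearCombination : ∀ {m r} → Vector Carrier r → Vector (Vector Carrier m) r → Vector Carrier m
  linearCombination a v i = sum (λ j → a j * v j i)

  _∈Span_ : ∀ {m r} → Vector Carrier m → Vector (Vector Carrier m) r → Set (c ⊔ ℓ₁)
  _∈Span_ {r = r} w v = ∃[ a ] ∀ i → linearCombination {r = r} a v i ≈ w i

  LinearlyIndependent : ∀ {m r} → Vector (Vector Carrier m) r → Set (c ⊔ ℓ₁)
  LinearlyIndependent v = ∀ a → (∀ i → linearCombination a v i ≈ 0#) → ∀ j → a j ≈ 0#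

  record IsBasis {m r p} (V : Vector Carrier m → Set p) (b : Vector (Vector Carrier m) r)
                 : Set (c ⊔ ℓ₁ ⊔ p) where
    field
      members     : ∀ j → V (b j)
      independent : LinearlyIndependent b
      spanning    : ∀ w → V w → w ∈Span b

  HasDimension : ∀ {m p} → (Vector Carrier m → Set p) → ℕ → Set (c ⊔ ℓ₁ ⊔ p)
  HasDimension {m} V r = ∃[ b ] IsBasis {m} {r} V b

  ColumnSpace : ∀ {m n} → Matrix Carrier m n → Vector Carrier m → Set (c ⊔ ℓ₁)
  ColumnSpace A w = w ∈Span (λ j i → A i j)

  HasRank : ∀ {m n} → Matrix Carrier m n → ℕ → Set (c ⊔ ℓ₁)
  HasRank A r = HasDimension (ColumnSpace A) r

  infixl 6 _⊕_ _⊖_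
  infixr 7 _·_

  _⊕_ _⊖_ : ∀ {m n} → Matrix Carrier m n → Matrix Carrier m n → Matrix Carrier m n
  (A ⊕ B) i j = A i j + B i j
  (A ⊖ B) i j = A i j - B i j

  _·_ : ∀ {m n} → Carrier → Matrix Carrier m n → Matrix Carrier m n
  (a · A) i j = a * A i j

  𝟎 : ∀ {m n} → Matrix Carrier m n
  𝟎 _ _ = 0#

  𝐈 : ∀ n → Matrix Carrier n n
  𝐈 _ i j = if ⌊ i ≟ j ⌋ then 1# else 0#

  𝐞 𝐨 : ∀ {m} → Vector Carrier m
  𝐞 _ = 1#
  𝐨 _ = 0#

  -- block a r s D is the matrix [ a r′ ; s D ].
  block : ∀ {m} → Carrier → Vector Carrier m → Vector Carrier m → Matrix Carrier m m →
          Matrix Carrier (suc m) (suc m)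
  block a r s D zero    zero    = a
  block a r s D zero    (suc j) = r j
  block a r s D (suc i) zero    = s i
  block a r s D (suc i) (suc j) = D i j

  shiftRight : ∀ {m} → Vector Carrier m → Vector Carrier m
  shiftRight {zero}  v = v
  shiftRight {suc m} v = last v ∷ init v

  circRow : ∀ {m} → Vector Carrier m → ℕ → Vector Carrier m
  circRow v zero    = v
  circRow v (suc i) = shiftRight (circRow v i)

  Circ : ∀ {m} → Vector Carrier m → Matrix Carrier m m
  Circ v i = circRow v (toℕ i)

  -- p₀, p₁, p₂, p₀, p₁, p₂, … cut off at length m.
  periodic : ∀ {m} → Vector Carrier 3 → Vector Carrier m
  periodic p j = p (toℕ j mod 3)

  -- For n ≡ 2 (mod 3) the tail of x̄ has length n - 2 ≡ 0, so its last block
  -- is complete; for n ≡ 0 (mod 3) the tail of ȳ has length n - 2 ≡ 1, so it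
  -- ends with a lone 2.
  x̄ ȳ : ∀ n → Vector Carrier (n ∸ 1)
  x̄ zero            = []
  x̄ (suc zero)      = []
  x̄ n@(suc (suc _)) = (fromℕ 2 - fromℕ n) ∷ periodic (1# ∷ - fromℕ 2 ∷ 1# ∷ [])
  ȳ zero            = []
  ȳ (suc zero)      = []
  ȳ n@(suc (suc _)) = (- fromℕ n) ∷ periodic (fromℕ 2 ∷ - 1# ∷ - 1# ∷ [])

  module _ (char0 : CharacteristicZero) where

    ⅓ : Carrier
    ⅓ = inverse (fromℕ 3) (char0 2)

    -- The value for n ≡ 1 (mod 3) is a placeholder.
    M : ∀ n → Matrix Carrier (n ∸ 1) (n ∸ 1)
    M n with n % 3
    ... | 2 = ⅓ · Circ (x̄ n)
    ... | 0 = ⅓ · Circ (ȳ n)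
    ... | _ = 𝟎

    L̃ : ∀ n → Matrix Carrier n n
    L̃ zero      = []
    L̃ n@(suc m) = ((fromℕ n - 1#) * ⅓) · 𝐈 n
                 ⊖ ⅓ · block 0# 𝐞 𝐞 𝟎
                 ⊕ block 0# 𝐨 𝐨 (M n)

{-# OPTIONS --safe #-}

-- Write 3 L̃ = [ n-1 , -e′ ; -e , C ].  The diagonal shift turns
-- the circulant block into C = Circ(c) for a 3-periodic c whose period sums to
-- zero: (1,1,-2,1,1,-2,…,1) or (-1,2,-1,-1,2,-1,…,-1,2).  If T is the cyclic
-- shift, then in both cases c + T c + T² c is three times the second unit
-- vector, so three cyclically consecutive rows of C add up to three times a
-- unit vector and C is invertible.  The same identity shows that the entries
-- of c sum to 1.  Hence every row of L̃ sums to 0, and the last n - 1 columns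
-- of L̃ form a basis of its column space.

module Submission where

open import Defs
open import Algebra.Apartness.Bundles using (HeytingField; HeytingCommutativeRing)
open import Algebra.Bundles using (CommutativeRing)
import Algebra.Properties.Ring as RingProperties
import Algebra.Properties.Semiring.Sum as SemiringSum
import Algebra.Solver.Ring.NaturalCoefficients.Default as CommutativeSemiringSolver
open import Data.Fin.Base as Fin using (Fin; zero; suc; toℕ; inject₁)
open import Data.Fin.Properties
  using (_≟_; toℕ-injective; toℕ-fromℕ; toℕ-fromℕ<; toℕ-inject₁; toℕ<n)
open import Data.Nat.Base as ℕ using (ℕ; zero; suc; _≤_; _∸_; s≤s; NonZero)
open import Data.Nat.DivMod
  using (_%_; _mod_; m%n<n; m<n⇒m%n≡m; n%n≡0; %-distribˡ-+; m%n%n≡m%n; [m+n]%n≡m%n)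
import Data.Nat.Properties as ℕ
open import Data.Product.Base using (_,_; proj₁; proj₂)
open import Data.Vec.Functional using (Vector; []; _∷_; last; init)
open import Function.Base using (_∘_)
open import Relation.Binary.PropositionalEquality as ≡ using (_≡_; _≢_)
open import Relation.Nullary.Decidable using (yes; no)
open import Relation.Nullary.Negation using (contradiction)

-- Residues as indices in `Fin m`.

mod-unique : ∀ {m} .{{_ : NonZero m}} x {j : Fin m} → x % m ≡ toℕ j → x mod m ≡ j
mod-unique {m} x eq = toℕ-injective (≡.trans (toℕ-fromℕ< (m%n<n x m)) eq)

mod-cong : ∀ {m} .{{_ : NonZero m}} x y → x % m ≡ y % m → x mod m ≡ y mod m
mod-cong {m} x y eq = mod-unique x (≡.trans eq (≡.sym (toℕ-fromℕ< (m%n<n y m))))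

toℕ-mod : ∀ {m} .{{_ : NonZero m}} (j : Fin m) → toℕ j mod m ≡ j
toℕ-mod j = mod-unique (toℕ j) (m<n⇒m%n≡m (toℕ<n j))

mod-absorbʳ : ∀ {m} .{{_ : NonZero m}} x y → (x ℕ.+ toℕ (y mod m)) mod m ≡ (x ℕ.+ y) mod m
mod-absorbʳ {m} x y = mod-cong (x ℕ.+ toℕ (y mod m)) (x ℕ.+ y) (begin
  (x ℕ.+ toℕ (y mod m)) % m    ≡⟨ ≡.cong (λ z → (x ℕ.+ z) % m) (toℕ-fromℕ< (m%n<n y m)) ⟩
  (x ℕ.+ y % m) % m            ≡⟨ %-distribˡ-+ x (y % m) m ⟩
  (x % m ℕ.+ y % m % m) % m    ≡⟨ ≡.cong (λ z → (x % m ℕ.+ z) % m) (m%n%n≡m%n y m) ⟩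
  (x % m ℕ.+ y % m) % m        ≡⟨ %-distribˡ-+ x y m ⟨
  (x ℕ.+ y) % m                ∎)
  where
  open ≡.≡-Reasoning

mod-absorbˡ : ∀ {m} .{{_ : NonZero m}} x y → (toℕ (x mod m) ℕ.+ y) mod m ≡ (x ℕ.+ y) mod m
mod-absorbˡ {m} x y
  rewrite ℕ.+-comm (toℕ (x mod m)) y | ℕ.+-comm x y = mod-absorbʳ y x

module _ {ℓ₀ ℓ₁ ℓ₂} (F : HeytingField ℓ₀ ℓ₁ ℓ₂) where

  open FieldDefs F
  open HeytingField F using (#⇒invertible)
  open CommutativeRing (HeytingCommutativeRing.commutativeRing (HeytingField.heytingCommutativeRing F))
    hiding (zero)
  open RingProperties ring
  open SemiringSum semiring
  open CommutativeSemiringSolver commutativeSemiring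
    using (solve; _:=_; _:+_; _:*_; con)
  open import Relation.Binary.Reasoning.Setoid setoid

  -- Dot products, and the rank of a matrix whose rows sum to zero.

  infix 7 _∙_
  _∙_ : ∀ {m} → Vector Carrier m → Vector Carrier m → Carrier
  _∙_ {m} u v = sum {m} (λ j → u j * v j)

  ∙-cong : ∀ {m} {u u′ v v′ : Vector Carrier m} →
           (∀ j → u j ≈ u′ j) → (∀ j → v j ≈ v′ j) → u ∙ v ≈ u′ ∙ v′
  ∙-cong u≈u′ v≈v′ = sum-cong-≋ (λ j → *-cong (u≈u′ j) (v≈v′ j))

  ∙-congˡ : ∀ {m} (u : Vector Carrier m) {v v′ : Vector Carrier m} →
            (∀ j → v j ≡ v′ j) → u ∙ v ≈ u ∙ v′
  ∙-congˡ u v≡v′ = ∙-cong {u = u} (λ _ → refl) (reflexive ∘ v≡v′)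

  ∙-distribʳ : ∀ {m} (a u v : Vector Carrier m) → (λ j → u j + v j) ∙ a ≈ u ∙ a + v ∙ a
  ∙-distribʳ a u v = trans (sum-cong-≋ (λ j → distribʳ (a j) (u j) (v j)))
                           (∑-distrib-+ (λ j → u j * a j) (λ j → v j * a j))

  zero-∙ : ∀ {m} {u : Vector Carrier m} → (∀ j → u j ≈ 0#) → ∀ a → u ∙ a ≈ 0#
  zero-∙ {m} u≈0 a = trans (sum-cong-≋ (λ j → trans (*-congʳ (u≈0 j)) (zeroˡ (a j))))
                           (sum-replicate-zero m)

  𝐈-suc : ∀ {n} (i j : Fin n) → 𝐈 (suc n) (suc i) (suc j) ≈ 𝐈 n i j
  𝐈-suc i j with i ≟ j
  ... | yes _ = refl
  ... | no  _ = refl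

  𝐈-∙ : ∀ {n} (i : Fin n) (a : Vector Carrier n) → 𝐈 n i ∙ a ≈ a i
  𝐈-∙ {suc n} zero a = begin
    1# * a zero + (λ j → 𝐈 (suc n) zero (suc j)) ∙ (a ∘ suc)
      ≈⟨ +-cong (*-identityˡ _) (zero-∙ {u = λ _ → 0#} (λ _ → refl) (a ∘ suc)) ⟩
    a zero + 0#  ≈⟨ +-identityʳ _ ⟩
    a zero       ∎
  𝐈-∙ {suc n} (suc i) a = begin
    0# * a zero + (λ j → 𝐈 (suc n) (suc i) (suc j)) ∙ (a ∘ suc)
      ≈⟨ +-cong (zeroˡ _) (∙-cong (𝐈-suc i) (λ _ → refl)) ⟩
    0# + 𝐈 n i ∙ (a ∘ suc)  ≈⟨ +-identityˡ _ ⟩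
    𝐈 n i ∙ (a ∘ suc)       ≈⟨ 𝐈-∙ i (a ∘ suc) ⟩
    a (suc i)               ∎

  -- Vanishing row sums make column 0 the negative of the sum of the other columns. A combination
  -- with coefficients `a` is therefore unchanged when `a zero` is subtracted from every later
  -- coefficient and column 0 is dropped.
  rank-of-tail-columns : ∀ {p m} (A : Matrix Carrier p (suc m)) →
    LinearlyIndependent (λ j i → A i (suc j)) →
    (∀ i → sum (A i) ≈ 0#) →
    HasRank A m
  rank-of-tail-columns A independent rowSum≈0 = (λ j i → A i (suc j)) , record
    { members     = λ j → 𝐈 _ (suc j) , λ i → 𝐈-∙ (suc j) (A i)
    ; independent = independent
    ; spanning    = λ w → λ { (a , spans) →
        (λ j → a (suc j) - a zero) , λ i → trans (dropHead a i) (spans i) }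
    }
    where
    dropHead : ∀ a i → (λ j → a (suc j) - a zero) ∙ (λ j → A i (suc j)) ≈ a ∙ A i
    dropHead a i = begin
      (λ j → a (suc j) - a zero) ∙ tailRow
        ≈⟨ ∙-distribʳ tailRow (a ∘ suc) (λ _ → - a zero) ⟩
      (a ∘ suc) ∙ tailRow + (λ _ → - a zero) ∙ tailRow
        ≈⟨ +-congˡ (*-distribˡ-sum (- a zero) tailRow) ⟨
      (a ∘ suc) ∙ tailRow + - a zero * sum tailRow
        -- The only use of the row sum: the tail of the row sums to `- A i zero`, and the two signs
        -- then cancel to restore the head term.
        ≈⟨ +-congˡ (*-congˡ (+-inverseʳ-unique _ _ (rowSum≈0 i))) ⟩
      (a ∘ suc) ∙ tailRow + - a zero * - A i zero
        ≈⟨ +-congˡ (trans (trans (sym (-‿distribˡ-* _ _)) (-‿cong (sym (-‿distribʳ-* _ _))))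
                          (-‿involutive _)) ⟩
      (a ∘ suc) ∙ tailRow + a zero * A i zero
        ≈⟨ +-comm _ _ ⟩
      a ∙ A i  ∎
      where
      tailRow = λ j → A i (suc j)

  -- Cyclic rotations, circulant rows and the three-term identity.

  rotate : ∀ {k} → ℕ → Vector Carrier (suc k) → Vector Carrier (suc k)
  rotate {k} i a j = a ((i ℕ.+ toℕ j) mod suc k)

  rotate-rotate : ∀ {k} i i′ (a : Vector Carrier (suc k)) j →
                  rotate i (rotate i′ a) j ≡ rotate (i′ ℕ.+ i) a j
  rotate-rotate {k} i i′ a j = ≡.cong a (≡.trans (mod-absorbʳ i′ (i ℕ.+ toℕ j))
    (≡.cong (_mod suc k) (≡.sym (ℕ.+-assoc i′ i (toℕ j)))))

  rotate-mod : ∀ {k} i (a : Vector Carrier (suc k)) j →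
               rotate (toℕ (i mod suc k)) a j ≡ rotate i a j
  rotate-mod i a j = ≡.cong a (mod-absorbˡ i (toℕ j))

  -- Adjointness: a right shift of one factor is a left rotation of the other. Moving the head
  -- summand to the end aligns the two sums; only the last index wraps around, to 0.
  shiftRight-∙ : ∀ {k} (v a : Vector Carrier (suc k)) → shiftRight v ∙ a ≈ v ∙ rotate 1 a
  shiftRight-∙ {k} v a = begin
    last v * a zero + init v ∙ (a ∘ suc)
      ≈⟨ +-comm _ _ ⟩
    init v ∙ (a ∘ suc) + last v * a zero
      ≈⟨ +-cong (∙-congˡ (init v) (λ j → ≡.cong a (≡.sym (mod-unique (suc (toℕ (inject₁ j))) (succ j)))))
                (*-congˡ (reflexive (≡.cong a (≡.sym (mod-unique (suc (toℕ (Fin.fromℕ k))) wrap))))) ⟩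
    init v ∙ init (rotate 1 a) + last v * last (rotate 1 a)
      ≈⟨ sum-init-last (λ j → v j * rotate 1 a j) ⟨
    v ∙ rotate 1 a  ∎
    where
    succ : ∀ (j : Fin k) → suc (toℕ (inject₁ j)) % suc k ≡ suc (toℕ j)
    succ j rewrite toℕ-inject₁ j = m<n⇒m%n≡m (s≤s (toℕ<n j))
    wrap : suc (toℕ (Fin.fromℕ k)) % suc k ≡ 0
    wrap rewrite toℕ-fromℕ k = n%n≡0 (suc k)

  -- Each of the `i` shifts that build the row passes to the other factor by adjointness. Thus
  -- applying a circulant matrix to `a` means pairing its one defining vector with the rotations of
  -- `a`.
  circRow-∙ : ∀ {k} (v : Vector Carrier (suc k)) i a → circRow v i ∙ a ≈ v ∙ rotate i a
  circRow-∙ v zero    a = ∙-congˡ v (λ j → ≡.cong a (≡.sym (toℕ-mod j)))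
  circRow-∙ v (suc i) a = begin
    shiftRight (circRow v i) ∙ a  ≈⟨ shiftRight-∙ (circRow v i) a ⟩
    circRow v i ∙ rotate 1 a      ≈⟨ circRow-∙ v i (rotate 1 a) ⟩
    v ∙ rotate i (rotate 1 a)     ≈⟨ ∙-congˡ v (rotate-rotate i 1 a) ⟩
    v ∙ rotate (suc i) a          ∎

  -- The identity c + T c + T² c = 3 e₁ (indices from 0), tested against every a.
  ThreeTermInverse : ∀ {l} → Vector Carrier (suc (suc l)) → Set _
  ThreeTermInverse c = ∀ a → c ∙ a + c ∙ rotate 1 a + c ∙ rotate 2 a ≈ fromℕ 3 * a (suc zero)

  -- Entry `j` of the sum `s` of the three shifts is a window of three cyclically consecutive values
  -- ending at `j`. From index 2 on the window lies inside the vector and vanishes. The window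
  -- ending at 0 wraps around, but `closes` lets `f` continue through the seam, so it vanishes as
  -- well. The window ending at 1 is the exception, with value 3.
  threeTermInverse : ∀ {l} (f : ℕ → Carrier) →
    (∀ i → f i + f (1 ℕ.+ i) + f (2 ℕ.+ i) ≈ 0#) →
    f (2 ℕ.+ l) ≈ f 0 →
    f (1 ℕ.+ l) + f 0 + f 1 ≈ fromℕ 3 →
    ThreeTermInverse {l} (f ∘ toℕ)
  threeTermInverse {l} f window closes three a = begin
    c ∙ a + c ∙ rotate 1 a + c ∙ rotate 2 a
      ≈⟨ +-cong (+-congˡ (circRow-∙ c 1 a)) (circRow-∙ c 2 a) ⟨
    c ∙ a + circRow c 1 ∙ a + circRow c 2 ∙ a
      ≈⟨ +-congʳ (∙-distribʳ a c (circRow c 1)) ⟨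
    (λ j → c j + circRow c 1 j) ∙ a + circRow c 2 ∙ a
      ≈⟨ ∙-distribʳ a (λ j → c j + circRow c 1 j) (circRow c 2) ⟨
    s ∙ a
      ≈⟨ +-cong (*-congʳ s₀) (+-cong (*-congʳ s₁) (zero-∙ s₂₊ (λ j → a (suc (suc j))))) ⟩
    0# * a zero + (fromℕ 3 * a (suc zero) + 0#)
      ≈⟨ +-cong (zeroˡ _) (+-identityʳ _) ⟩
    0# + fromℕ 3 * a (suc zero)
      ≈⟨ +-identityˡ _ ⟩
    fromℕ 3 * a (suc zero)  ∎
    where
    c : Vector Carrier (suc (suc l))
    c = f ∘ toℕ
    s : Vector Carrier (suc (suc l))
    s j = c j + circRow c 1 j + circRow c 2 j
    -- The successive shifts list a window by descending index, the hypotheses by ascending index.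
    reverse : ∀ x y z → x + y + z ≈ z + y + x
    reverse = solve 3 (λ x y z → x :+ y :+ z := z :+ y :+ x) refl
    s₀ : s zero ≈ 0#
    s₀ rewrite toℕ-inject₁ (Fin.fromℕ l) | toℕ-fromℕ l =
      trans (+-congʳ (+-congʳ (sym closes))) (trans (reverse _ _ _) (window l))
    s₁ : s (suc zero) ≈ fromℕ 3
    s₁ rewrite toℕ-fromℕ l = trans (reverse _ _ _) three
    s₂₊ : ∀ j → s (suc (suc j)) ≈ 0#
    s₂₊ j rewrite toℕ-inject₁ (inject₁ j) | toℕ-inject₁ j =
      trans (reverse _ _ _) (window (toℕ j))

  -- Sequences of period three.

  -- The argument order puts the diagonal entry `γ` at index 0, so the tail of the circulant's first
  -- row, which repeats `α`, `β`, `γ`, is the same sequence read from index 1.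
  cycle : Carrier → Carrier → Carrier → ℕ → Carrier
  cycle γ α β 0 = γ
  cycle γ α β 1 = α
  cycle γ α β 2 = β
  cycle γ α β (suc (suc (suc i))) = cycle γ α β i

  cycle-window : ∀ {γ α β} → γ + α + β ≈ 0# → ∀ i →
    cycle γ α β i + cycle γ α β (1 ℕ.+ i) + cycle γ α β (2 ℕ.+ i) ≈ 0#
  cycle-window sum≈0 0 = sum≈0
  cycle-window sum≈0 1 = trans (solve 3 (λ x y z → y :+ z :+ x := x :+ y :+ z) refl _ _ _) sum≈0
  cycle-window sum≈0 2 = trans (solve 3 (λ x y z → z :+ x :+ y := x :+ y :+ z) refl _ _ _) sum≈0
  cycle-window sum≈0 (suc (suc (suc i))) = cycle-window sum≈0 i

  periodic-cycle : ∀ γ α β i → (α ∷ β ∷ γ ∷ []) (i mod 3) ≡ cycle γ α β (suc i)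
  periodic-cycle γ α β 0 = ≡.refl
  periodic-cycle γ α β 1 = ≡.refl
  periodic-cycle γ α β 2 = ≡.refl
  periodic-cycle γ α β (suc (suc (suc i))) = periodic-cycle γ α β i

  cycle-% : ∀ γ α β i l → cycle γ α β (i ℕ.+ l) ≡ cycle γ α β (i ℕ.+ l % 3)
  -- With `l` as the first summand, three successors of `l` are stripped by computation on both
  -- sides.
  cycle-% γ α β i l rewrite ℕ.+-comm i l | ℕ.+-comm i (l % 3) = go l
    where
    go : ∀ l → cycle γ α β (l ℕ.+ i) ≡ cycle γ α β (l % 3 ℕ.+ i)
    go 0 = ≡.refl
    go 1 = ≡.refl
    go 2 = ≡.refl
    go (suc (suc (suc l))) = go l

  -- Division by three, and inversion of the circulant.

  module _ (char0 : CharacteristicZero) where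

    ⅓*3≈1 : ⅓ char0 * fromℕ 3 ≈ 1#
    ⅓*3≈1 = begin
      ⅓ char0 * fromℕ 3         ≈⟨ *-congˡ (trans (+-congˡ -0#≈0#) (+-identityʳ _)) ⟨
      ⅓ char0 * (fromℕ 3 - 0#)  ≈⟨ proj₁ (proj₂ (#⇒invertible (char0 2))) ⟩
      1#                        ∎

    ⅓*-cancel : ∀ {x y} → fromℕ 3 * x ≈ y → x ≈ ⅓ char0 * y
    ⅓*-cancel {x} {y} eq = begin
      x                        ≈⟨ *-identityˡ x ⟨
      1# * x                   ≈⟨ *-congʳ ⅓*3≈1 ⟨
      ⅓ char0 * fromℕ 3 * x    ≈⟨ *-assoc _ _ _ ⟩
      ⅓ char0 * (fromℕ 3 * x)  ≈⟨ *-congˡ eq ⟩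
      ⅓ char0 * y              ∎

    3*-cancel : ∀ {x} → ⅓ char0 * x ≈ 0# → x ≈ 0#
    3*-cancel {x} eq = begin
      x                        ≈⟨ *-identityˡ x ⟨
      1# * x                   ≈⟨ *-congʳ (trans (*-comm _ _) ⅓*3≈1) ⟨
      fromℕ 3 * ⅓ char0 * x    ≈⟨ *-assoc _ _ _ ⟩
      fromℕ 3 * (⅓ char0 * x)  ≈⟨ *-congˡ eq ⟩
      fromℕ 3 * 0#             ≈⟨ zeroʳ _ ⟩
      0#                       ∎

    module _ {l} (c : Vector Carrier (suc (suc l))) (inv : ThreeTermInverse c) where

      -- The three-term identity, applied to a suitable rotation of `a`, writes `3 * a j` as a sum
      -- of three pairings of `c` with rotations of `a`, all of which vanish.
      correlation-injective : ∀ a → (∀ (i : Fin (suc (suc l))) → c ∙ rotate (toℕ i) a ≈ 0#) →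
                              ∀ j → a j ≈ 0#
      correlation-injective a c∙a≈0 j = begin
        a j                                         ≡⟨ ≡.cong a entry ⟨
        b (suc zero)                                ≈⟨ ⅓*-cancel (sym (inv b)) ⟩
        ⅓ char0 * (c ∙ b + c ∙ rotate 1 b + c ∙ rotate 2 b)
          ≈⟨ *-congˡ (+-cong (+-cong (c∙b≈0 (suc l ℕ.+ toℕ j)) (c∙rotate-b≈0 1)) (c∙rotate-b≈0 2)) ⟩
        ⅓ char0 * (0# + 0# + 0#)                    ≈⟨ *-congˡ (trans (+-identityʳ _) (+-identityʳ _)) ⟩
        ⅓ char0 * 0#                                ≈⟨ zeroʳ _ ⟩
        0#                                          ∎
        where
        b : Vector Carrier (suc (suc l))
        -- The identity reads off index 1, so `a j` has to be moved there: a rotation by `j - 1`,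
        -- where `suc l` stands for -1 modulo the length.
        b = rotate (suc l ℕ.+ toℕ j) a
        entry : (suc l ℕ.+ toℕ j ℕ.+ 1) mod suc (suc l) ≡ j
        entry = mod-unique (suc l ℕ.+ toℕ j ℕ.+ 1) (≡.trans
          (≡.cong (_% suc (suc l)) (≡.trans (ℕ.+-comm (suc l ℕ.+ toℕ j) 1) (ℕ.+-comm (suc (suc l)) (toℕ j))))
          (≡.trans ([m+n]%n≡m%n (toℕ j) (suc (suc l))) (m<n⇒m%n≡m (toℕ<n j))))
        c∙b≈0 : ∀ i → c ∙ rotate i a ≈ 0#
        c∙b≈0 i = trans (sym (∙-congˡ c (rotate-mod i a))) (c∙a≈0 (i mod suc (suc l)))
        c∙rotate-b≈0 : ∀ i → c ∙ rotate i b ≈ 0#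
        c∙rotate-b≈0 i = trans (∙-congˡ c (rotate-rotate i (suc l ℕ.+ toℕ j) a))
                               (c∙b≈0 (suc l ℕ.+ toℕ j ℕ.+ i))

      -- The all-ones vector is fixed by every rotation, so the three-term identity becomes
      -- `3 * (c ∙ 𝐞) = 3`.
      ∙-ones : c ∙ 𝐞 ≈ 1#
      ∙-ones = begin
        c ∙ 𝐞                    ≈⟨ ⅓*-cancel refl ⟩
        ⅓ char0 * (fromℕ 3 * (c ∙ 𝐞))
          ≈⟨ *-congˡ (solve 1 (λ x → (con 1 :+ (con 1 :+ (con 1 :+ con 0))) :* x := x :+ x :+ x) refl (c ∙ 𝐞)) ⟩
        ⅓ char0 * (c ∙ 𝐞 + c ∙ 𝐞 + c ∙ 𝐞)  ≈⟨ *-congˡ (trans (inv 𝐞) (*-identityʳ _)) ⟩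
        ⅓ char0 * fromℕ 3        ≈⟨ ⅓*3≈1 ⟩
        1#                       ∎

    -- Here `c` is `v` with the diagonal shift `n - 1` absorbed into its entry 0, so the lower right
    -- block of `L̃` is one third of `Circ c`.
    rank-L̃ : ∀ {l} (v c : Vector Carrier (suc (suc l))) →
      let n = suc (suc (suc l)) in
      (∀ i j → M char0 n i j ≡ (⅓ char0 · Circ v) i j) →
      (fromℕ n - 1#) + v zero ≈ c zero →
      (∀ j → v (suc j) ≈ c (suc j)) →
      ThreeTermInverse c →
      HasRank (L̃ char0 n) (suc (suc l))
    rank-L̃ {l} v c M≡ diagonal offDiagonal inv =
      rank-of-tail-columns (L̃ char0 n)
        -- The rows below the first already force `Circ c` to annihilate `a`.
        (λ a a∙≈0 → correlation-injective c inv a (λ i →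
          3*-cancel (trans (sym (lowerRow i a)) (a∙≈0 (suc i)))))
        rowSum≈0
      where
      n = suc (suc (suc l))
      d = fromℕ n - 1#
      t = ⅓ char0

      entry : ∀ i j → L̃ char0 n (suc i) (suc j) ≈ t * (d * 𝐈 (suc (suc l)) i j + Circ v i j)
      entry i j = begin
        d * t * 𝐈 n (suc i) (suc j) + - (t * 0#) + M char0 n i j
          ≈⟨ +-cong (+-cong (*-congˡ (𝐈-suc i j)) (trans (-‿cong (zeroʳ t)) -0#≈0#)) (reflexive (M≡ i j)) ⟩
        d * t * 𝐈 (suc (suc l)) i j + 0# + t * Circ v i j
          ≈⟨ solve 4 (λ d t x y → d :* t :* x :+ con 0 :+ t :* y := t :* (d :* x :+ y)) refl d t _ _ ⟩
        t * (d * 𝐈 (suc (suc l)) i j + Circ v i j)  ∎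

      lowerRow : ∀ i a → a ∙ (λ j → L̃ char0 n (suc i) (suc j)) ≈ t * (c ∙ rotate (toℕ i) a)
      lowerRow i a = begin
        a ∙ (λ j → L̃ char0 n (suc i) (suc j))
          ≈⟨ sum-cong-≋ (λ j → trans (*-congˡ (entry i j))
               (solve 5 (λ a t d x y → a :* (t :* (d :* x :+ y)) := t :* (d :* (x :* a) :+ y :* a))
                      refl (a j) t d _ _)) ⟩
        sum (λ j → t * (d * (𝐈 _ i j * a j) + Circ v i j * a j))
          ≈⟨ *-distribˡ-sum t (λ j → d * (𝐈 _ i j * a j) + Circ v i j * a j) ⟨
        t * sum (λ j → d * (𝐈 _ i j * a j) + Circ v i j * a j)
          ≈⟨ *-congˡ (∑-distrib-+ (λ j → d * (𝐈 _ i j * a j)) (λ j → Circ v i j * a j)) ⟩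
        t * (sum (λ j → d * (𝐈 _ i j * a j)) + Circ v i ∙ a)
          ≈⟨ *-congˡ (+-cong (trans (sym (*-distribˡ-sum d (λ j → 𝐈 _ i j * a j))) (*-congˡ (𝐈-∙ i a)))
                             (circRow-∙ v (toℕ i) a)) ⟩
        t * (d * a i + v ∙ b)
          -- Rotation by `i` brings `a i` to index 0, where the diagonal term `d * a i` merges with
          -- the head term of `v ∙ b`.
          ≈⟨ *-congˡ (+-congʳ (*-congˡ (reflexive (≡.cong a i+0≡i)))) ⟨
        t * (d * b zero + v ∙ b)
          ≈⟨ *-congˡ (solve 4 (λ d x v r → d :* x :+ (v :* x :+ r) := (d :+ v) :* x :+ r)
                            refl d (b zero) (v zero) _) ⟩
        t * ((d + v zero) * b zero + (v ∘ suc) ∙ (b ∘ suc))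
          ≈⟨ *-congˡ (+-cong (*-congʳ diagonal) (∙-cong {v = b ∘ suc} offDiagonal (λ _ → refl))) ⟩
        t * (c ∙ b)  ∎
        where
        b = rotate (toℕ i) a
        i+0≡i : (toℕ i ℕ.+ 0) mod suc (suc l) ≡ i
        i+0≡i = ≡.trans (≡.cong (_mod suc (suc l)) (ℕ.+-identityʳ (toℕ i))) (toℕ-mod i)

      border : ∀ x → x * 0# + - (t * 1#) + 0# ≈ - t
      border x = begin
        x * 0# + - (t * 1#) + 0#  ≈⟨ +-identityʳ _ ⟩
        x * 0# + - (t * 1#)       ≈⟨ +-cong (zeroʳ x) (-‿cong (*-identityʳ t)) ⟩
        0# + - t                  ≈⟨ +-identityˡ _ ⟩
        - t                       ∎

      rowSum≈0 : ∀ i → sum (L̃ char0 n i) ≈ 0#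
      rowSum≈0 zero = begin
        d * t * 1# + - (t * 0#) + 0# + sum (λ j → L̃ char0 n zero (suc j))
          ≈⟨ +-cong (trans (+-identityʳ _) (+-cong (*-identityʳ _) (trans (-‿cong (zeroʳ t)) -0#≈0#)))
                    (sum-cong-≋ {suc (suc l)} (λ j → trans (border (d * t)) (sym (*-identityˡ _)))) ⟩
        d * t + 0# + sum {suc (suc l)} (λ j → 1# * - t)
          ≈⟨ +-cong (+-identityʳ _) (sym (*-distribʳ-sum (- t) (𝐞 {suc (suc l)}))) ⟩
        d * t + sum (𝐞 {suc (suc l)}) * - t
          -- The corner entry is `(n - 1) * t`, and the border contributes `n - 1` copies of `- t`.
          ≈⟨ +-cong (*-congʳ d≈) (*-congʳ (sum-replicate (suc (suc l)))) ⟩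
        fromℕ (suc (suc l)) * t + fromℕ (suc (suc l)) * - t
          ≈⟨ distribˡ _ t (- t) ⟨
        fromℕ (suc (suc l)) * (t - t)
          ≈⟨ *-congˡ (-‿inverseʳ t) ⟩
        fromℕ (suc (suc l)) * 0#
          ≈⟨ zeroʳ _ ⟩
        0#  ∎
        where
        d≈ : d ≈ fromℕ (suc (suc l))
        d≈ = xyx⁻¹≈y 1# (fromℕ (suc (suc l)))
      rowSum≈0 (suc i) = begin
        d * t * 0# + - (t * 1#) + 0# + sum (λ j → L̃ char0 n (suc i) (suc j))
          ≈⟨ +-cong (border (d * t)) (sum-cong-≋ (λ j → sym (*-identityˡ (L̃ char0 n (suc i) (suc j))))) ⟩
        - t + 𝐞 ∙ (λ j → L̃ char0 n (suc i) (suc j))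
          ≈⟨ +-congˡ (lowerRow i 𝐞) ⟩
        - t + t * (c ∙ 𝐞)
          -- The entries of `c` sum to 1, so the block row contributes exactly `t` and balances the
          -- border entry `- t`.
          ≈⟨ +-congˡ (trans (*-congˡ (∙-ones c inv)) (*-identityʳ t)) ⟩
        - t + t
          ≈⟨ -‿inverseˡ t ⟩
        0#  ∎

    -- The two residue classes.

    M-≡2 : ∀ n → n % 3 ≡ 2 → M char0 n ≡ ⅓ char0 · Circ (x̄ n)
    M-≡2 n eq rewrite eq = ≡.refl

    M-≡0 : ∀ n → n % 3 ≡ 0 → M char0 n ≡ ⅓ char0 · Circ (ȳ n)
    M-≡0 n eq rewrite eq = ≡.refl

    [x-y]+[z-x]≈z-y : ∀ x y z → (x - y) + (z - x) ≈ z - y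
    [x-y]+[z-x]≈z-y x y z = begin
      (x - y) + (z - x)
        ≈⟨ solve 4 (λ x y′ x′ z → (x :+ y′) :+ (z :+ x′) := (z :+ y′) :+ (x :+ x′)) refl x (- y) (- x) z ⟩
      (z - y) + (x - x)    ≈⟨ +-congˡ (-‿inverseʳ x) ⟩
      (z - y) + 0#         ≈⟨ +-identityʳ _ ⟩
      z - y                ∎

    rank-≡2 : ∀ l → l % 3 ≡ 2 → HasRank (L̃ char0 (suc (suc (suc l)))) (suc (suc l))
    rank-≡2 l l≡2 = rank-L̃ (x̄ n) (f ∘ toℕ)
      (λ i j → ≡.cong (λ A → A i j) (M-≡2 n l≡2))
      -- The diagonal entry is `(n - 1) + (2 - n) = 1`.
      (trans ([x-y]+[z-x]≈z-y _ _ _) (trans (xyx⁻¹≈y 1# _) (+-identityʳ 1#)))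
      (λ j → reflexive (periodic-cycle 1# 1# (- fromℕ 2) (toℕ j)))
      -- For `l` congruent to 2, `f (2 + l)` is `f 4 = f 1 = 1`, which equals `f 0`; the exceptional
      -- window is `1 + 1 + 1`.
      (threeTermInverse f (cycle-window period≈0) (reflexive (f-% 2)) three)
      where
      n = suc (suc (suc l))
      f = cycle 1# 1# (- fromℕ 2)
      f-% : ∀ i → f (i ℕ.+ l) ≡ f (i ℕ.+ 2)
      f-% i = ≡.trans (cycle-% _ _ _ i l) (≡.cong (λ r → f (i ℕ.+ r)) l≡2)
      period≈0 : 1# + 1# - fromℕ 2 ≈ 0#
      period≈0 = trans (+-congʳ (+-congˡ (sym (+-identityʳ 1#)))) (-‿inverseʳ _)
      three : f (1 ℕ.+ l) + 1# + 1# ≈ fromℕ 3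
      three = trans (+-congʳ (+-congʳ (reflexive (f-% 1))))
        (solve 1 (λ u → u :+ u :+ u := u :+ (u :+ (u :+ con 0))) refl 1#)

    rank-≡0 : ∀ l → l % 3 ≡ 0 → HasRank (L̃ char0 (suc (suc (suc l)))) (suc (suc l))
    rank-≡0 l l≡0 = rank-L̃ (ȳ n) (f ∘ toℕ)
      (λ i j → ≡.cong (λ A → A i j) (M-≡0 n l≡0))
      -- Reading `- n` as `0 - n` lets the same telescoping give the diagonal entry
      -- `(n - 1) - n = - 1`.
      (trans (+-congˡ (sym (+-identityˡ _))) (trans ([x-y]+[z-x]≈z-y _ _ _) (+-identityˡ _)))
      (λ j → reflexive (periodic-cycle (- 1#) (fromℕ 2) (- 1#) (toℕ j)))
      -- For `l` congruent to 0, `f (2 + l)` is `f 2 = - 1`, which equals `f 0`; the exceptional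
      -- window is `2 - 1 + 2`.
      (threeTermInverse f (cycle-window period≈0) (reflexive (f-% 2)) three)
      where
      n = suc (suc (suc l))
      f = cycle (- 1#) (fromℕ 2) (- 1#)
      f-% : ∀ i → f (i ℕ.+ l) ≡ f (i ℕ.+ 0)
      f-% i = ≡.trans (cycle-% _ _ _ i l) (≡.cong (λ r → f (i ℕ.+ r)) l≡0)
      period≈0 : - 1# + fromℕ 2 - 1# ≈ 0#
      period≈0 = begin
        - 1# + fromℕ 2 - 1#
          ≈⟨ solve 2 (λ u w → w :+ (u :+ (u :+ con 0)) :+ w := (u :+ w) :+ (u :+ w)) refl 1# (- 1#) ⟩
        (1# - 1#) + (1# - 1#)  ≈⟨ +-cong (-‿inverseʳ 1#) (-‿inverseʳ 1#) ⟩
        0# + 0#                ≈⟨ +-identityʳ 0# ⟩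
        0#                     ∎
      three : f (1 ℕ.+ l) - 1# + fromℕ 2 ≈ fromℕ 3
      three = begin
        f (1 ℕ.+ l) - 1# + fromℕ 2  ≈⟨ +-congʳ (+-congʳ (reflexive (f-% 1))) ⟩
        fromℕ 2 - 1# + fromℕ 2
          ≈⟨ solve 2 (λ u w → (u :+ (u :+ con 0)) :+ w :+ (u :+ (u :+ con 0)) :=
                              (u :+ (u :+ (u :+ con 0))) :+ (u :+ w)) refl 1# (- 1#) ⟩
        fromℕ 3 + (1# - 1#)         ≈⟨ +-congˡ (-‿inverseʳ 1#) ⟩
        fromℕ 3 + 0#                ≈⟨ +-identityʳ _ ⟩
        fromℕ 3                     ∎

theorem5p13 : ∀ {c ℓ₁ ℓ₂} (F : HeytingField c ℓ₁ ℓ₂) →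
    let open FieldDefs F in
    (char0 : CharacteristicZero) →
    (n : ℕ) → 8 ≤ n → n % 3 ≢ 1 →
    HasRank (L̃ char0 n) (n ∸ 1)
-- With `n` written as `3 + l`, `n % 3` computes to `l % 3`, so the case split can be made on `l`.
theorem5p13 F char0 (suc (suc (suc l))) _ l≢1 = residue (l % 3) ≡.refl (m%n<n l 3)
  where
  open FieldDefs F
  residue : ∀ r → l % 3 ≡ r → r ℕ.< 3 → HasRank (L̃ char0 (suc (suc (suc l)))) (suc (suc l))
  residue 0 l≡0 _ = rank-≡0 F char0 l l≡0
  residue 1 l≡1 _ = contradiction l≡1 l≢1
  residue 2 l≡2 _ = rank-≡2 F char0 l l≡2
  residue (suc (suc (suc _))) _ (s≤s (s≤s (s≤s ())))
theorem5p13 F char0 1 (s≤s ()) _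
theorem5p13 F char0 2 (s≤s (s≤s ())) _
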